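{- Let $t\ge 2$ be an integer. Then the (outerplanar) graph $H(2t-2)$ is $(\frac{4}{2},t+1)^*$-colorable, but is not $(\frac{4}{2},t)^*$-colorable.
   Context: For an integer $m\ge 1$, $H(m)$ is the graph with vertex set $\{x,x_1,\dots,x_m\}\cup\{y,y_1,\dots,y_m\}\cup\{z,z_1,\dots,z_m\}$ and edge set the union of $\{x_ix_{i+1}: 1\le i\le m-1\}$, $\{y_iy_{i+1}: 1\le i\le m-1\}$, $\{z_iz_{i+1}: 1\le i\le m-1\}$, $\{x_my,\ y_mz,\ z_mx,\ xy,\ yz,\ zx\}$, $\{xx_i:1\le i\le m\}$, $\{yy_i:1\le i\le m\}$ and $\{zz_i:1\le i\le m\}$. It is an outerplanar graph (it has a planar drawing in which all vertices lie on the outer face). For a positive integer $k$ and $i,j\in\{0,1,\dots,k-1\}$, the circular distance is $|i-j|_k=\min\{|i-j|,\,k-|i-j|\}$. For a nonnegative integer $t$, a $(\frac{k}{2},t)^*$-coloring of a graph $G$ is a mapping $f:V(G)\to\{0,1,\dots,k-1\}$ such that adjacent vertices receive different integers and, for each vertex $u$, the number of neighbors $v$ of $u$ with $|f(u)-f(v)|_k=1$ is at most $t$. $G$ is $(\frac{k}{2},t)^*$-colorable if it has such a coloring. (The symbol $\frac{k}{2}$ is formal notation recording the pair $(k,2)$, not a reduced fraction; so $\frac{4}{2}$ means $k=4$.) -}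

module Defs where

open import Data.Nat.Base using (ℕ; suc; _≤_; _∸_; _⊓_; ∣_-_∣)
open import Data.Nat.Properties using (_≟_; 1+n≢n)
open import Data.Fin.Base using (Fin; toℕ)
open import Data.List.Base using (List; []; _∷_; _++_; map; filter; length; allFin; cartesianProductWith)
open import Data.List.Membership.Propositional using (_∈_; _∉_)
open import Data.List.Membership.Propositional.Properties
  using (∈-allFin; ∈-map⁺; ∈-map⁻; ∈-++⁺ˡ; ∈-++⁺ʳ; ∈-cartesianProductWith⁺; ∈-cartesianProductWith⁻)
open import Data.List.Relation.Unary.All using ([]; _∷_)
open import Data.List.Relation.Unary.AllPairs using ([]; _∷_)
open import Data.List.Relation.Unary.Any using (here; there)
open import Data.List.Relation.Unary.Unique.Propositional using (Unique)
import Data.List.Relation.Unary.Unique.Propositional.Properties as Unique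
open import Data.Product.Base using (_×_; _,_; ∃)
open import Data.Sum.Base using (_⊎_; inj₁; inj₂; swap)
open import Relation.Binary.Definitions using (Symmetric; Irreflexive; Decidable)
open import Relation.Binary.PropositionalEquality using (_≡_; _≢_; refl; sym)
open import Relation.Nullary.Decidable using (yes; no; map′; _×-dec_; _⊎-dec_)

record FiniteSimpleGraph : Set₁ where
  field
    Vertex   : Set
    vertices : List Vertex
    complete : ∀ v → v ∈ vertices
    unique   : Unique vertices
    Adj      : Vertex → Vertex → Set
    adj?     : Decidable Adj
    symm     : Symmetric Adj
    irrefl   : Irreflexive _≡_ Adj

-- The truncated subtraction is exact, since the residues lie in {0,…,k-1}.
circDist : ∀ {k} → Fin k → Fin k → ℕ
circDist {k} i j = ∣ toℕ i - toℕ j ∣ ⊓ (k ∸ ∣ toℕ i - toℕ j ∣)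

module _ (G : FiniteSimpleGraph) where
  open FiniteSimpleGraph G

  neighboursAtDistance1 : ∀ {k} → (Vertex → Fin k) → Vertex → List Vertex
  neighboursAtDistance1 f u =
    filter (λ v → adj? u v ×-dec (circDist (f u) (f v) ≟ 1)) vertices

  -- A (k/2 , t)*-coloring; "k/2" is formal notation for the pair (k , 2).
  record IsColoring (k t : ℕ) (f : Vertex → Fin k) : Set where
    field
      proper : ∀ {u v} → Adj u v → f u ≢ f v
      defect : ∀ u → length (neighboursAtDistance1 f u) ≤ t

  Colorable : (k t : ℕ) → Set
  Colorable k t = ∃ λ (f : Vertex → Fin k) → IsColoring k t f

data Letter : Set where
  X Y Z : Letter

-- hub X is x, and leaf X i is x_{i+1}, as Fin m counts from 0; likewise for
-- y and z.
data HVertex (m : ℕ) : Set where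
  hub  : Letter → HVertex m
  leaf : Letter → Fin m → HVertex m

-- Each edge is listed in one orientation only; HAdj is the symmetric closure.
data HEdge (m : ℕ) : HVertex m → HVertex m → Set where
  path  : ∀ {a i j} → toℕ j ≡ suc (toℕ i) → HEdge m (leaf a i) (leaf a j)
  spoke : ∀ {a i} → HEdge m (hub a) (leaf a i)
  xₘy   : ∀ {i} → suc (toℕ i) ≡ m → HEdge m (leaf X i) (hub Y)
  yₘz   : ∀ {i} → suc (toℕ i) ≡ m → HEdge m (leaf Y i) (hub Z)
  zₘx   : ∀ {i} → suc (toℕ i) ≡ m → HEdge m (leaf Z i) (hub X)
  xy    : HEdge m (hub X) (hub Y)
  yz    : HEdge m (hub Y) (hub Z)
  zx    : HEdge m (hub Z) (hub X)

HAdj : (m : ℕ) → HVertex m → HVertex m → Set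
HAdj m u v = HEdge m u v ⊎ HEdge m v u

_≟ᴸ_ : Decidable {A = Letter} _≡_
X ≟ᴸ X = yes refl
X ≟ᴸ Y = no λ ()
X ≟ᴸ Z = no λ ()
Y ≟ᴸ X = no λ ()
Y ≟ᴸ Y = yes refl
Y ≟ᴸ Z = no λ ()
Z ≟ᴸ X = no λ ()
Z ≟ᴸ Y = no λ ()
Z ≟ᴸ Z = yes refl

hEdge? : ∀ m → Decidable (HEdge m)
hEdge? m (hub X) (hub X) = no λ ()
hEdge? m (hub X) (hub Y) = yes xy
hEdge? m (hub X) (hub Z) = no λ ()
hEdge? m (hub Y) (hub X) = no λ ()
hEdge? m (hub Y) (hub Y) = no λ ()
hEdge? m (hub Y) (hub Z) = yes yz
hEdge? m (hub Z) (hub X) = yes zx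
hEdge? m (hub Z) (hub Y) = no λ ()
hEdge? m (hub Z) (hub Z) = no λ ()
hEdge? m (hub a) (leaf b i) =
  map′ (λ { refl → spoke }) (λ { spoke → refl }) (a ≟ᴸ b)
hEdge? m (leaf X i) (hub X) = no λ ()
hEdge? m (leaf X i) (hub Y) = map′ xₘy (λ { (xₘy p) → p }) (suc (toℕ i) ≟ m)
hEdge? m (leaf X i) (hub Z) = no λ ()
hEdge? m (leaf Y i) (hub X) = no λ ()
hEdge? m (leaf Y i) (hub Y) = no λ ()
hEdge? m (leaf Y i) (hub Z) = map′ yₘz (λ { (yₘz p) → p }) (suc (toℕ i) ≟ m)
hEdge? m (leaf Z i) (hub X) = map′ zₘx (λ { (zₘx p) → p }) (suc (toℕ i) ≟ m)
hEdge? m (leaf Z i) (hub Y) = no λ ()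
hEdge? m (leaf Z i) (hub Z) = no λ ()
hEdge? m (leaf a i) (leaf b j) =
  map′ (λ { (refl , p) → path p }) (λ { (path p) → refl , p })
       ((a ≟ᴸ b) ×-dec (toℕ j ≟ suc (toℕ i)))

hEdge-irrefl : ∀ m → Irreflexive _≡_ (HEdge m)
hEdge-irrefl m refl (path p) = 1+n≢n (sym p)

letters : List Letter
letters = X ∷ Y ∷ Z ∷ []

letters-complete : ∀ a → a ∈ letters
letters-complete X = here refl
letters-complete Y = there (here refl)
letters-complete Z = there (there (here refl))

letters-unique : Unique letters
letters-unique = ((λ ()) ∷ (λ ()) ∷ []) ∷ ((λ ()) ∷ []) ∷ [] ∷ []

H : ℕ → FiniteSimpleGraph
H m = record
  { Vertex   = HVertex m
  ; vertices = hubs ++ leaves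
  ; complete = λ where
      (hub a)    → ∈-++⁺ˡ (∈-map⁺ hub (letters-complete a))
      (leaf a i) → ∈-++⁺ʳ hubs (∈-cartesianProductWith⁺ leaf (letters-complete a) (∈-allFin i))
  ; unique   = Unique.++⁺
      (Unique.map⁺ {f = hub} (λ { refl → refl }) letters-unique)
      (Unique.cartesianProductWith⁺ leaf (λ { refl → refl , refl }) letters-unique (Unique.allFin⁺ m))
      (λ { (p , q) → disjoint p q })
  ; Adj      = HAdj m
  ; adj?     = λ u v → hEdge? m u v ⊎-dec hEdge? m v u
  ; symm     = swap
  ; irrefl   = λ where
      refl (inj₁ e) → hEdge-irrefl m refl e
      refl (inj₂ e) → hEdge-irrefl m refl e
  }
  where
  hubs leaves : List (HVertex m)
  hubs   = map hub letters
  leaves = cartesianProductWith leaf letters (allFin m)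

  disjoint : ∀ {v} → v ∈ hubs → v ∉ leaves
  disjoint p q with ∈-map⁻ hub p | ∈-cartesianProductWith⁻ leaf letters (allFin m) q
  ... | _ , _ , refl | _ , _ , _ , _ , ()

{-# OPTIONS --safe #-}

-- Three distinct residues mod 4 always contain one at circular distance 1 from
-- the other two, so some hub sees both other hubs at distance 1.  Only one
-- residue is at distance 2 from that hub's colour, so of any two consecutive
-- leaves of its fan at least one is at distance 1.  Pairing up the 2t-2 leaves
-- gives t-1 such leaves, hence defect at least t+1.  Conversely, colouring the
-- leaves of odd index (x_1, x_3, …, and likewise for y and z) with the residue
-- opposite to their hub leaves exactly t-1 leaves of each fan at distance 1, and
-- the other leaf colours can be chosen so that each hub has at most two further
-- neighbours at distance 1.

module Submission where

open import Defs
open import Data.Nat.Base using (ℕ; zero; suc; _+_; _*_; _∸_; _≤_; z≤n; s≤s)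
open import Data.Nat.Properties
  using (_≟_; _<?_; even≢odd; +-suc; +-comm; +-identityʳ; +-cancelʳ-≡; *-comm; suc-injective;
         ≤-trans; ≤-reflexive; <-irrefl; 1+n≰n)
open import Data.Fin.Base using (Fin; zero; suc; toℕ; fromℕ; fromℕ<; pred; combine; remainder; quotient)
open import Data.Fin.Patterns using (0F; 1F; 2F; 3F)
import Data.Fin.Properties as Fin
open import Data.List.Base using (List; []; _∷_; _++_; map; length; allFin)
open import Data.List.Properties using (length-map; length-tabulate)
open import Data.List.Membership.Propositional using (_∈_)
open import Data.List.Membership.Propositional.Properties
  using (∈-∃++; ∈-filter⁺; ∈-filter⁻; ∈-map⁺; ∈-allFin)
open import Data.List.Relation.Binary.Permutation.Propositional.Properties using (shift; ∈-resp-↭; ↭-length)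
open import Data.List.Relation.Binary.Subset.Propositional using (_⊆_)
open import Data.List.Relation.Unary.All using (All; []; _∷_; lookup)
import Data.List.Relation.Unary.All.Properties as All
open import Data.List.Relation.Unary.AllPairs using ([]; _∷_)
open import Data.List.Relation.Unary.Any using (here; there)
open import Data.List.Relation.Unary.Unique.Propositional using (Unique)
import Data.List.Relation.Unary.Unique.Propositional.Properties as Unique
open import Data.Product.Base using (_×_; _,_; ∃; proj₁; proj₂)
open import Data.Sum.Base using (_⊎_; inj₁; inj₂)
open import Function.Base using (_∘_)
open import Relation.Binary.PropositionalEquality
  using (_≡_; _≢_; refl; sym; trans; cong; subst; ≢-sym; module ≡-Reasoning)
open import Relation.Nullary.Decidable using (yes; no; from-yes; ¬?; _×-dec_; _⊎-dec_; _→-dec_)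
open import Relation.Nullary.Negation.Core using (¬_; contradiction)

-- Counting neighbours by comparing repetition-free lists.

unique-⊆⇒length≤ : ∀ {A : Set} {xs ys : List A} → Unique xs → xs ⊆ ys → length xs ≤ length ys
unique-⊆⇒length≤ []                 _     = z≤n
unique-⊆⇒length≤ {xs = x ∷ xs} (x∉xs ∷ uniq) xs⊆ys
  -- Delete one occurrence of the head `x` from `ys`; the tail still lies in what remains, because
  -- it does not contain `x`.
  with as , bs , refl ← ∈-∃++ (xs⊆ys (here refl)) =
  ≤-trans (s≤s (unique-⊆⇒length≤ uniq xs⊆as++bs)) (≤-reflexive (sym (↭-length (shift x as bs))))
  where
  xs⊆as++bs : xs ⊆ as ++ bs
  xs⊆as++bs y∈xs with ∈-resp-↭ (shift x as bs) (xs⊆ys (there y∈xs))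
  ... | here refl = contradiction refl (lookup x∉xs y∈xs)
  ... | there y∈  = y∈

module _ (G : FiniteSimpleGraph) where
  open FiniteSimpleGraph G

  module _ {k} (f : Vertex → Fin k) (u : Vertex) where

    Tight : Vertex → Set
    Tight v = Adj u v × circDist (f u) (f v) ≡ 1

    -- Only a cover is demanded: `ys` may hold repetitions and vertices that are not counted, so the
    -- explicit lists below can keep a uniform shape.
    length-neighboursAtDistance1-≤ : ∀ ys → (∀ {v} → Tight v → v ∈ ys) →
      length (neighboursAtDistance1 G f u) ≤ length ys
    length-neighboursAtDistance1-≤ ys tight∈ys =
      unique-⊆⇒length≤ (Unique.filter⁺ _ unique) (λ v∈ → tight∈ys (proj₂ (∈-filter⁻ _ {xs = vertices} v∈)))

    length-neighboursAtDistance1-≥ : ∀ {xs} → Unique xs → All Tight xs →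
      length xs ≤ length (neighboursAtDistance1 G f u)
    length-neighboursAtDistance1-≥ uniq tight =
      unique-⊆⇒length≤ uniq (λ {v} v∈ → ∈-filter⁺ _ (complete v) (lookup tight v∈))

-- Parity of leaf indices, with `combine q e` at index 2q + e.

toℕ-combine-odd : ∀ {s} (q : Fin s) → toℕ (combine {n = 2} q 1F) ≡ suc (toℕ (combine {n = 2} q 0F))
toℕ-combine-odd q = begin
  toℕ (combine q 1F)       ≡⟨ Fin.toℕ-combine {n = 2} q 1F ⟩
  2 * toℕ q + 1            ≡⟨ +-suc (2 * toℕ q) 0 ⟩
  suc (2 * toℕ q + 0)      ≡⟨ cong suc (Fin.toℕ-combine {n = 2} q 0F) ⟨
  suc (toℕ (combine q 0F)) ∎
  where open ≡-Reasoning

toℕ-quotient-remainder : ∀ {s} (i : Fin (s * 2)) → toℕ i ≡ 2 * toℕ (quotient {s} 2 i) + toℕ (remainder {s} 2 i)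
toℕ-quotient-remainder {s} i =
  trans (cong toℕ (sym (Fin.combine-remQuot {s} 2 i))) (Fin.toℕ-combine (quotient {s} 2 i) (remainder {s} 2 i))

odd⇒≡combine : ∀ {s} (i : Fin (s * 2)) → remainder {s} 2 i ≡ 1F → i ≡ combine (quotient {s} 2 i) 1F
odd⇒≡combine {s} i odd = trans (sym (Fin.combine-remQuot {s} 2 i)) (cong (combine (quotient {s} 2 i)) odd)

-- Equal remainders would cancel and make an even number equal to an odd one. Hence the two leaf
-- colours alternate along each path.
remainder-suc : ∀ {s} (i j : Fin (s * 2)) → toℕ j ≡ suc (toℕ i) → remainder {s} 2 i ≢ remainder {s} 2 j
remainder-suc {s} i j j≡1+i eq
  with remainder {s} 2 i | remainder {s} 2 j | toℕ-quotient-remainder {s} i | toℕ-quotient-remainder {s} j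
remainder-suc {s} i j j≡1+i refl | r | .r | i≡ | j≡ =
  even≢odd (toℕ (quotient {s} 2 j)) (toℕ (quotient {s} 2 i)) (+-cancelʳ-≡ (toℕ r) _ _ (trans (sym j≡) (trans j≡1+i (cong suc i≡))))

-- The number of leaves is even, so the last zero-based index is odd. This fixes the colour of the
-- leaf joined to the next hub.
remainder-last : ∀ {s} (i : Fin (s * 2)) → suc (toℕ i) ≡ s * 2 → remainder {s} 2 i ≡ 1F
remainder-last {s} i last with remainder {s} 2 i | toℕ-quotient-remainder {s} i
... | 1F | _  = refl
... | 0F | i≡ = contradiction
  (trans (*-comm 2 s) (trans (sym last) (cong suc (trans i≡ (+-identityʳ _)))))
  (even≢odd s (toℕ (quotient {s} 2 i)))

-- The neighbourhood of a leaf.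

next : Letter → Letter
next X = Y
next Y = Z
next Z = X

successor : ∀ {m} → Letter → Fin m → HVertex m
successor {m} a i with suc (toℕ i) <? m
... | yes 1+i<m = leaf a (fromℕ< 1+i<m)
... | no  _     = hub (next a)

successor-inner : ∀ {m} a (i j : Fin m) → toℕ j ≡ suc (toℕ i) → leaf a j ≡ successor a i
successor-inner {m} a i j j≡1+i with suc (toℕ i) <? m
... | yes 1+i<m = cong (leaf a) (Fin.toℕ-injective (trans j≡1+i (sym (Fin.toℕ-fromℕ< 1+i<m))))
... | no  1+i≮m = contradiction (subst (λ n → suc n ≤ m) j≡1+i (Fin.toℕ<n j)) 1+i≮m

successor-last : ∀ {m} a (i : Fin m) → suc (toℕ i) ≡ m → hub (next a) ≡ successor a i
successor-last {m} a i 1+i≡m with suc (toℕ i) <? m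
... | yes 1+i<m = contradiction 1+i<m (<-irrefl 1+i≡m)
... | no  _     = refl

predecessor : ∀ {m} (i j : Fin m) → toℕ i ≡ suc (toℕ j) → j ≡ pred i
predecessor (suc i) j i≡1+j =
  Fin.toℕ-injective (trans (sym (suc-injective i≡1+j)) (sym (Fin.toℕ-inject₁ i)))

-- Three entries suffice. At index 0 `pred` returns the same index, so the second entry is then the
-- leaf itself, a harmless filler.
leafNeighbours : ∀ {m} → Letter → Fin m → List (HVertex m)
leafNeighbours a i = hub a ∷ leaf a (pred i) ∷ successor a i ∷ []

leaf-adj⇒∈ : ∀ {m} a (i : Fin m) {v} → HAdj m (leaf a i) v → v ∈ leafNeighbours a i
leaf-adj⇒∈ a i (inj₁ (path {j = j} p)) = there (there (here (successor-inner a i j p)))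
leaf-adj⇒∈ X i (inj₁ (xₘy p))          = there (there (here (successor-last X i p)))
leaf-adj⇒∈ Y i (inj₁ (yₘz p))          = there (there (here (successor-last Y i p)))
leaf-adj⇒∈ Z i (inj₁ (zₘx p))          = there (there (here (successor-last Z i p)))
leaf-adj⇒∈ a i (inj₂ (path {i = j} p)) = there (here (cong (leaf a) (predecessor i j p)))
leaf-adj⇒∈ a i (inj₂ spoke)            = here refl

-- The colouring of defect at most 2 + s.

-- `X` takes the middle residue; `Y` and `Z` are opposite, so neither counts the other.
hubColour : Letter → Fin 4
hubColour X = 1F
hubColour Y = 0F
hubColour Z = 2F

-- As Fin indices start from 0, remainder 0F belongs to x_1, x_3, ….
leafColour : Letter → Fin 2 → Fin 4
leafColour X 0F = 3F
leafColour X 1F = 2F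
leafColour Y 0F = 2F
leafColour Y 1F = 1F
leafColour Z 0F = 0F
leafColour Z 1F = 3F

colour : ∀ s → HVertex (s * 2) → Fin 4
colour s (hub a)    = hubColour a
colour s (leaf a i) = leafColour a (remainder {s} 2 i)

leafColour-injective : ∀ a {p q} → leafColour a p ≡ leafColour a q → p ≡ q
leafColour-injective a {0F} {0F} _ = refl
leafColour-injective a {1F} {1F} _ = refl
leafColour-injective X {0F} {1F} ()
leafColour-injective Y {0F} {1F} ()
leafColour-injective Z {0F} {1F} ()
leafColour-injective X {1F} {0F} ()
leafColour-injective Y {1F} {0F} ()
leafColour-injective Z {1F} {0F} ()

hubColour≢leafColour : ∀ a p → hubColour a ≢ leafColour a p
hubColour≢leafColour X 0F ()
hubColour≢leafColour X 1F ()
hubColour≢leafColour Y 0F ()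
hubColour≢leafColour Y 1F ()
hubColour≢leafColour Z 0F ()
hubColour≢leafColour Z 1F ()

leafColour-tight : ∀ a p → circDist (hubColour a) (leafColour a p) ≡ 1 → p ≡ 1F
leafColour-tight X 0F ()
leafColour-tight Y 0F ()
leafColour-tight Z 0F ()
leafColour-tight _ 1F _ = refl

colour-edge : ∀ s {u v} → HEdge (s * 2) u v → colour s u ≢ colour s v
colour-edge s (path {a} {i} {j} p) eq = remainder-suc {s} i j p (leafColour-injective a eq)
colour-edge s (spoke {a} {i})      eq = hubColour≢leafColour a (remainder {s} 2 i) eq
colour-edge s (xₘy {i} p)          eq with remainder {s} 2 i | remainder-last {s} i p
colour-edge s (xₘy {i} p)          () | _ | refl
colour-edge s (yₘz {i} p)          eq with remainder {s} 2 i | remainder-last {s} i p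
colour-edge s (yₘz {i} p)          () | _ | refl
colour-edge s (zₘx {i} p)          eq with remainder {s} 2 i | remainder-last {s} i p
colour-edge s (zₘx {i} p)          () | _ | refl
colour-edge s xy                   ()
colour-edge s yz                   ()
colour-edge s zx                   ()

-- Odd refers to the zero-based index: these are x_2, x_4, ..., the leaves at distance 1 from their
-- own hub.
oddLeaves : ∀ s → Letter → List (HVertex (s * 2))
oddLeaves s a = map (λ q → leaf a (combine q 1F)) (allFin s)

length-oddLeaves : ∀ s a → length (oddLeaves s a) ≡ s
length-oddLeaves s a = trans (length-map _ (allFin s)) (length-tabulate {n = s} _)

leaf∈oddLeaves : ∀ s a (i : Fin (s * 2)) → circDist (hubColour a) (leafColour a (remainder {s} 2 i)) ≡ 1 →
  leaf a i ∈ oddLeaves s a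
leaf∈oddLeaves s a i d =
  subst (λ j → leaf a j ∈ oddLeaves s a) (sym (odd⇒≡combine {s} i (leafColour-tight a _ d)))
    (∈-map⁺ _ (∈-allFin (quotient {s} 2 i)))

module _ (n : ℕ) where
  private
    s m : ℕ
    -- Positivity of `s` provides a last leaf and makes 2 + s at least 3, the bound used for leaves.
    s = suc n
    m = s * 2

  -- For Y the second entry is a mere filler making all lists equally long.
  hubTight : Letter → List (HVertex m)
  hubTight X = hub Y ∷ hub Z ∷ oddLeaves s X
  hubTight Y = hub X ∷ hub Z ∷ oddLeaves s Y
  hubTight Z = hub X ∷ leaf Y (fromℕ _) ∷ oddLeaves s Z

  length-hubTight : ∀ a → length (hubTight a) ≡ 2 + s
  length-hubTight X = cong (2 +_) (length-oddLeaves s X)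
  length-hubTight Y = cong (2 +_) (length-oddLeaves s Y)
  length-hubTight Z = cong (2 +_) (length-oddLeaves s Z)

  tight⇒∈hubTight : ∀ a {v} → Tight (H m) (colour s) (hub a) v → v ∈ hubTight a
  tight⇒∈hubTight X (inj₁ (spoke {i = i}) , d) = there (there (leaf∈oddLeaves s X i d))
  tight⇒∈hubTight Y (inj₁ (spoke {i = i}) , d) = there (there (leaf∈oddLeaves s Y i d))
  tight⇒∈hubTight Z (inj₁ (spoke {i = i}) , d) = there (there (leaf∈oddLeaves s Z i d))
  tight⇒∈hubTight X (inj₁ xy , d)              = here refl
  tight⇒∈hubTight Y (inj₁ yz , ())
  tight⇒∈hubTight Z (inj₁ zx , d)              = here refl
  tight⇒∈hubTight X (inj₂ zx , d)              = there (here refl)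
  tight⇒∈hubTight Y (inj₂ xy , d)              = here refl
  tight⇒∈hubTight Z (inj₂ yz , ())
  -- The last leaf of `Z` has colour 3, opposite to 1 at hub `X`; in the next case 2 is opposite to
  -- 0.
  tight⇒∈hubTight X (inj₂ (zₘx {i} p) , d) with remainder {s} 2 i | remainder-last {s} i p
  tight⇒∈hubTight X (inj₂ (zₘx {i} p) , ()) | _ | refl
  tight⇒∈hubTight Y (inj₂ (xₘy {i} p) , d) with remainder {s} 2 i | remainder-last {s} i p
  tight⇒∈hubTight Y (inj₂ (xₘy {i} p) , ()) | _ | refl
  -- Here the colours are 1 and 2, so the last leaf of `Y` does count at hub `Z`.
  tight⇒∈hubTight Z (inj₂ (yₘz {i} p) , d) =
    there (here (cong (leaf Y) (Fin.toℕ-injective (trans (suc-injective p) (sym (Fin.toℕ-fromℕ _))))))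

  colour-isColoring : IsColoring (H m) 4 (2 + s) (colour s)
  colour-isColoring = record
    { proper = λ where
        (inj₁ e) → colour-edge s e
        (inj₂ e) → ≢-sym (colour-edge s e)
    ; defect = λ where
        (hub a)    → ≤-trans
          (length-neighboursAtDistance1-≤ (H m) (colour s) (hub a) (hubTight a) (tight⇒∈hubTight a))
          (≤-reflexive (length-hubTight a))
        (leaf a i) → ≤-trans
          (length-neighboursAtDistance1-≤ (H m) (colour s) (leaf a i) (leafNeighbours a i)
            (leaf-adj⇒∈ a i ∘ proj₁))
          (s≤s (s≤s (s≤s z≤n)))
    }

-- The lower bound for an arbitrary proper colouring.

near-or-near : ∀ (p u v : Fin 4) → p ≢ u → p ≢ v → u ≢ v → circDist p u ≡ 1 ⊎ circDist p v ≡ 1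
near-or-near = from-yes (Fin.all? λ (p : Fin 4) → Fin.all? λ u → Fin.all? λ v →
  ¬? (p Fin.≟ u) →-dec (¬? (p Fin.≟ v) →-dec (¬? (u Fin.≟ v) →-dec
    ((circDist p u ≟ 1) ⊎-dec (circDist p v ≟ 1)))))

-- Exactly one residue is missing, and the one opposite to it is next to the other two. The proof
-- evaluates all triples.
middle : ∀ (x y z : Fin 4) → x ≢ y → y ≢ z → z ≢ x →
  (circDist x y ≡ 1 × circDist x z ≡ 1) ⊎
  (circDist y z ≡ 1 × circDist y x ≡ 1) ⊎
  (circDist z x ≡ 1 × circDist z y ≡ 1)
middle = from-yes (Fin.all? λ (x : Fin 4) → Fin.all? λ y → Fin.all? λ z →
  ¬? (x Fin.≟ y) →-dec (¬? (y Fin.≟ z) →-dec (¬? (z Fin.≟ x) →-dec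
    (((circDist x y ≟ 1) ×-dec (circDist x z ≟ 1)) ⊎-dec
     (((circDist y z ≟ 1) ×-dec (circDist y x ≟ 1)) ⊎-dec
      ((circDist z x ≟ 1) ×-dec (circDist z y ≟ 1)))))))

module _ (s : ℕ) (f : HVertex (s * 2) → Fin 4) (proper : ∀ {u v} → HAdj (s * 2) u v → f u ≢ f v) where
  private
    m : ℕ
    m = s * 2

  tightLeaf : ∀ a (q : Fin s) → ∃ λ e → circDist (f (hub a)) (f (leaf a (combine q e))) ≡ 1
  tightLeaf a q
    with near-or-near (f (hub a)) (f (leaf a (combine q 0F))) (f (leaf a (combine q 1F)))
           (proper (inj₁ spoke)) (proper (inj₁ spoke)) (proper (inj₁ (path (toℕ-combine-odd q))))
  ... | inj₁ d = 0F , d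
  ... | inj₂ d = 1F , d

  -- Two hubs and one leaf from each of the `s` index pairs are all distinct and all counted at
  -- `hub a`.
  middle⇒defect : ∀ {a b c} → b ≢ c → Tight (H m) f (hub a) (hub b) → Tight (H m) f (hub a) (hub c) →
    2 + s ≤ length (neighboursAtDistance1 (H m) f (hub a))
  middle⇒defect {a} b≢c tb tc = ≤-trans
    (≤-reflexive (cong (2 +_) (sym (length-tabulate pick))))
    (length-neighboursAtDistance1-≥ (H m) f (hub a)
      (((λ { refl → b≢c refl }) ∷ All.tabulate⁺ (λ _ ())) ∷ All.tabulate⁺ (λ _ ()) ∷ Unique.tabulate⁺ pick-injective)
      (tb ∷ tc ∷ All.tabulate⁺ (λ q → inj₁ spoke , proj₂ (tightLeaf a q))))
    where
    pick : Fin s → HVertex m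
    pick q = leaf a (combine q (proj₁ (tightLeaf a q)))

    leaf-injective : ∀ {i j : Fin m} → leaf a i ≡ leaf a j → i ≡ j
    leaf-injective refl = refl

    pick-injective : ∀ {p q} → pick p ≡ pick q → p ≡ q
    -- The quotient recovers the pair, whichever of its two leaves was picked.
    pick-injective eq = Fin.combine-injectiveˡ _ _ _ _ (leaf-injective eq)

  some-hub-defect : ∃ λ a → 2 + s ≤ length (neighboursAtDistance1 (H m) f (hub a))
  some-hub-defect with middle _ _ _ (proper (inj₁ xy)) (proper (inj₁ yz)) (proper (inj₁ zx))
  ... | inj₁ (dy , dz)        = X , middle⇒defect (λ ()) (inj₁ xy , dy) (inj₂ zx , dz)
  ... | inj₂ (inj₁ (dz , dx)) = Y , middle⇒defect (λ ()) (inj₁ yz , dz) (inj₂ xy , dx)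
  ... | inj₂ (inj₂ (dx , dy)) = Z , middle⇒defect (λ ()) (inj₁ zx , dx) (inj₂ yz , dy)

¬colorable : ∀ s → ¬ Colorable (H (s * 2)) 4 (suc s)
¬colorable s (f , isColoring) with a , 2+s≤ ← some-hub-defect s f (IsColoring.proper isColoring) =
  1+n≰n (≤-trans 2+s≤ (IsColoring.defect isColoring (hub a)))

theorem5p9 : ∀ (t : ℕ) → 2 ≤ t →
    Colorable (H (2 * t ∸ 2)) 4 (t + 1) × ¬ Colorable (H (2 * t ∸ 2)) 4 t
theorem5p9 (suc zero) (s≤s ())
-- With t = 1 + s, the rewrites turn 2t - 2 into `s * 2` and t + 1 into 2 + s.
theorem5p9 (suc s@(suc n)) _ rewrite cong (_∸ 2) (*-comm 2 (suc s)) | +-comm (suc s) 1 =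
  (colour s , colour-isColoring n) , ¬colorable s
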